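{- Let $E$ be a finite set and $\mathcal{L}\subseteq 2^E$. If $\mathcal{L}$ is inductively toggle-alternating, then $\mathcal{L}$ is toggle-alternating.
   Context: For a finite set $E$ and $\mathcal{L}\subseteq 2^E$, the toggle of $e\in E$ is the map $t_e:\mathcal{L}\to\mathcal{L}$ with $t_e(X)=X\cup\{e\}$ if $e\notin X$ and $X\cup\{e\}\in\mathcal{L}$; $t_e(X)=X\setminus\{e\}$ if $e\in X$ and $X\setminus\{e\}\in\mathcal{L}$; and $t_e(X)=X$ otherwise. The (generalized) toggle group $T(\mathcal{L})$ is the subgroup of the symmetric group $\mathfrak{S}_{\mathcal{L}}$ generated by $\{t_e \mid e\in E\}$. $\mathcal{L}$ is toggle-alternating if $T(\mathcal{L})$ contains the alternating group $A_{\mathcal{L}}$. An essentialization of $(\mathcal{L},E)$ is a pair $(\mathcal{L}',E')$ obtained as follows. Every $e\in E'$ must be an element of $E$ such that there exist $X,Y\in\mathcal{L}$ with $e\in X$ and $e\notin Y$ (no element of $E'$ lies in all or in none of the subsets in $\mathcal{L}$). Also, if $Z\subseteq E$, $|Z|>1$, is such that whenever $e\in Z$ and $e\in W\in\mathcal{L}$ we have $Z\subseteq W$, then for any maximal such $Z$ all elements of $Z$ except one are excluded from $E'$. All other elements of $E$ are kept in $E'$. Finally $\mathcal{L}'=\{X\cap E' \mid X\in\mathcal{L}\}$. For $e\in E$ put $\mathcal{L}_e=\{X\in\mathcal{L}\mid e\in X\}$ and $\mathcal{L}_{\bar e}=\{X\in\mathcal{L}\mid e\notin X\}$, and for $S\subseteq\mathcal{L}$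 put $t_e(S)=\{t_e(X)\mid X\in S\}$ (with $t_e$ the toggle on $\mathcal{L}$). Inductively toggle-alternating is defined recursively: $\mathcal{L}\subseteq 2^E$, with essentialization $(\mathcal{L}',E')$, is inductively toggle-alternating if (1) in case $|E'|\le 4$: $\mathcal{L}$ is toggle-alternating; (2) in case $|E'|\ge 5$: there exists $e\in E'$ such that at least one of the following holds: (a) $\mathcal{L}_e$ is inductively toggle-alternating, $\mathcal{L}_e\cup t_e(\mathcal{L}_e)=\mathcal{L}$, and $\mathcal{L}_e\cap t_e(\mathcal{L}_e)\neq\emptyset$; or (b) $\mathcal{L}_{\bar e}$ is inductively toggle-alternating, $\mathcal{L}_{\bar e}\cup t_e(\mathcal{L}_{\bar e})=\mathcal{L}$, and $\mathcal{L}_{\bar e}\cap t_e(\mathcal{L}_{\bar e})\neq\emptyset$. -}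

module Defs where

open import Algebra.Bundles using (Group)
open import Data.Bool.Base using (Bool; not; _∧_; T; true; false)
open import Data.Bool.Properties using (T?; T-irrelevant)
open import Data.Fin.Base using (Fin; zero; suc)
open import Data.Fin.Subset
  using (Subset; _∈_; _∉_; _⊆_; _∪_; _∩_; _-_; ⁅_⁆; ∣_∣; inside; outside)
open import Data.Fin.Subset.Properties
  using (_∈?_; ∪-identityʳ; p─⊥≡p; x∈p∪q⁺; x∈⁅x⁆)
open import Data.List.Base using (List; length; foldr)
open import Data.List.Relation.Unary.All using (All)
open import Data.Nat.Base using (ℕ; _≤_; _<_)
open import Data.Nat.Divisibility using (_∣_)
open import Data.Product.Base using (∃; ∃-syntax; _×_; _,_; proj₁; proj₂; Σ-syntax)
open import Data.Sum.Base using (inj₂)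
open import Data.Vec.Base using (_∷_; here; there)
open import Function.Base using (_∘_)
open import Function.Bundles using (_↔_; _⇔_; Inverse; mk↔ₛ′)
open import Function.Construct.Composition using (_↔-∘_)
open import Function.Construct.Identity using (↔-id)
open import Function.Construct.Symmetry using (↔-sym)
open import Level using (Level; 0ℓ; _⊔_)
open import Relation.Binary.PropositionalEquality
  using (_≡_; _≢_; refl; sym; trans; cong)
open import Relation.Nullary using (¬_; yes; no; does; contradiction)
open import Relation.Unary as U using (Pred; Satisfiable; Universal)

open Inverse using (to; from)

private
  variable
    a c ℓ p : Level
    n : ℕ

module _ (G : Group c ℓ) where
  open Group G

  data Generated (P : Pred Carrier p) : Pred Carrier (c ⊔ ℓ ⊔ p) where
    gen  : ∀ {x} → P x → Generated P x
    unit : Generated P ε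
    mul  : ∀ {x y} → Generated P x → Generated P y → Generated P (x ∙ y)
    inv  : ∀ {x} → Generated P x → Generated P (x ⁻¹)
    resp : ∀ {x y} → x ≈ y → Generated P x → Generated P y

-- The product π ∙ ρ is "first ρ, then π"; equality is pointwise.
Sym : Set a → Group a a
Sym A = record
  { Carrier = A ↔ A
  ; _≈_     = λ π ρ → ∀ x → to π x ≡ to ρ x
  ; _∙_     = λ π ρ → π ↔-∘ ρ
  ; ε       = ↔-id A
  ; _⁻¹     = ↔-sym
  ; isGroup = record
    { isMonoid = record
      { isSemigroup = record
        { isMagma = record
          { isEquivalence = record
            { refl  = λ _ → refl
            ; sym   = λ eq x → sym (eq x)
            ; trans = λ eq eq′ x → trans (eq x) (eq′ x)
            }
          ; ∙-cong = λ {π} {π′} {ρ} {ρ′} eq eq′ x →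
              trans (cong (to π) (eq′ x)) (eq (to ρ′ x))
          }
        ; assoc = λ _ _ _ _ → refl
        }
      ; identity = (λ _ _ → refl) , (λ _ _ → refl)
      }
    ; inverse = (λ π _ → Inverse.inverseʳ π refl)
              , (λ π _ → Inverse.inverseˡ π refl)
    ; ⁻¹-cong = λ {π} {ρ} eq x →
        Inverse.inverseʳ π (trans (sym (Inverse.inverseˡ ρ refl)) (sym (eq (from ρ x))))
    }
  }

IsTransposition : {A : Set a} → Pred (A ↔ A) a
IsTransposition π = ∃[ x ] ∃[ y ]
  x ≢ y × to π x ≡ y × to π y ≡ x × (∀ z → z ≢ x → z ≢ y → to π z ≡ z)

Alternating : (A : Set a) → Pred (A ↔ A) a
Alternating A π = Σ[ τs ∈ List (A ↔ A) ]
  All IsTransposition τs × 2 ∣ length τs × foldr _∙_ ε τs ≈ π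
  where open Group (Sym A)

-- The ground set E is Fin n; a family 𝓛 ⊆ 2^E is given by its characteristic
-- function, just as a Subset is.
Family : ℕ → Set
Family n = Subset n → Bool

infix 4 _∈ᶠ_

_∈ᶠ_ : Subset n → Family n → Set
X ∈ᶠ 𝓛 = T (𝓛 X)

Member : Family n → Set
Member {n} 𝓛 = Σ[ X ∈ Subset n ] X ∈ᶠ 𝓛

Member-≡ : {𝓛 : Family n} {X Y : Member 𝓛} → proj₁ X ≡ proj₁ Y → X ≡ Y
Member-≡ {X = X , p} {.X , q} refl = cong (X ,_) (T-irrelevant p q)

containing : Fin n → Family n → Family n
containing e 𝓛 X = 𝓛 X ∧ does (e ∈? X)

avoiding : Fin n → Family n → Family n
avoiding e 𝓛 X = 𝓛 X ∧ not (does (e ∈? X))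

add-remove : {X : Subset n} {e : Fin n} → e ∈ X → (X - e) ∪ ⁅ e ⁆ ≡ X
add-remove {X = _ ∷ X} here =
  cong (inside ∷_) (trans (∪-identityʳ _) (p─⊥≡p X))
add-remove {X = inside  ∷ _} (there e∈X) = cong (inside  ∷_) (add-remove e∈X)
add-remove {X = outside ∷ _} (there e∈X) = cong (outside ∷_) (add-remove e∈X)

remove-add : {X : Subset n} {e : Fin n} → e ∉ X → (X ∪ ⁅ e ⁆) - e ≡ X
remove-add {X = inside  ∷ X} {zero} e∉X = contradiction here e∉X
remove-add {X = outside ∷ X} {zero} e∉X =
  cong (outside ∷_) (trans (p─⊥≡p _) (∪-identityʳ X))
remove-add {X = inside  ∷ X} {suc e} e∉X = cong (inside  ∷_) (remove-add (e∉X ∘ there))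
remove-add {X = outside ∷ X} {suc e} e∉X = cong (outside ∷_) (remove-add (e∉X ∘ there))

e∉X-e : (X : Subset n) (e : Fin n) → e ∉ X - e
e∉X-e (inside  ∷ _) zero    ()
e∉X-e (outside ∷ _) zero    ()
e∉X-e (_ ∷ X)       (suc e) (there e∈X-e) = e∉X-e X e e∈X-e

module _ (𝓛 : Family n) where

  toggle : Fin n → Member 𝓛 → Member 𝓛
  toggle e (X , X∈𝓛) with e ∈? X
  toggle e (X , X∈𝓛) | no  e∉X with T? (𝓛 (X ∪ ⁅ e ⁆))
  ... | yes X∪e∈𝓛 = X ∪ ⁅ e ⁆ , X∪e∈𝓛
  ... | no  _     = X , X∈𝓛
  toggle e (X , X∈𝓛) | yes e∈X with T? (𝓛 (X - e))
  ... | yes X-e∈𝓛 = X - e , X-e∈𝓛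
  ... | no  _     = X , X∈𝓛

  toggle-∉ : ∀ {e X Y} (X∈𝓛 : X ∈ᶠ 𝓛) (Y∈𝓛 : Y ∈ᶠ 𝓛) →
             e ∉ X → X ∪ ⁅ e ⁆ ≡ Y → toggle e (X , X∈𝓛) ≡ (Y , Y∈𝓛)
  toggle-∉ {e} {X} X∈𝓛 Y∈𝓛 e∉X refl with e ∈? X
  ... | yes e∈X = contradiction e∈X e∉X
  ... | no  _ with T? (𝓛 (X ∪ ⁅ e ⁆))
  ...   | yes _   = Member-≡ refl
  ...   | no  Y∉𝓛 = contradiction Y∈𝓛 Y∉𝓛

  toggle-∈ : ∀ {e X Y} (X∈𝓛 : X ∈ᶠ 𝓛) (Y∈𝓛 : Y ∈ᶠ 𝓛) →
             e ∈ X → X - e ≡ Y → toggle e (X , X∈𝓛) ≡ (Y , Y∈𝓛)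
  toggle-∈ {e} {X} X∈𝓛 Y∈𝓛 e∈X refl with e ∈? X
  ... | no  e∉X = contradiction e∈X e∉X
  ... | yes _ with T? (𝓛 (X - e))
  ...   | yes _   = Member-≡ refl
  ...   | no  Y∉𝓛 = contradiction Y∈𝓛 Y∉𝓛

  toggle-∉-fixed : ∀ {e X} (X∈𝓛 : X ∈ᶠ 𝓛) → e ∉ X → ¬ (X ∪ ⁅ e ⁆ ∈ᶠ 𝓛) →
                   toggle e (X , X∈𝓛) ≡ (X , X∈𝓛)
  toggle-∉-fixed {e} {X} X∈𝓛 e∉X Y∉𝓛 with e ∈? X
  ... | yes e∈X = contradiction e∈X e∉X
  ... | no  _ with T? (𝓛 (X ∪ ⁅ e ⁆))
  ...   | yes Y∈𝓛 = contradiction Y∈𝓛 Y∉𝓛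
  ...   | no  _   = refl

  toggle-∈-fixed : ∀ {e X} (X∈𝓛 : X ∈ᶠ 𝓛) → e ∈ X → ¬ (X - e ∈ᶠ 𝓛) →
                   toggle e (X , X∈𝓛) ≡ (X , X∈𝓛)
  toggle-∈-fixed {e} {X} X∈𝓛 e∈X Y∉𝓛 with e ∈? X
  ... | no  e∉X = contradiction e∈X e∉X
  ... | yes _ with T? (𝓛 (X - e))
  ...   | yes Y∈𝓛 = contradiction Y∈𝓛 Y∉𝓛
  ...   | no  _   = refl

  toggle-involutive : ∀ e X → toggle e (toggle e X) ≡ X
  toggle-involutive e (X , X∈𝓛) with e ∈? X
  toggle-involutive e (X , X∈𝓛) | no e∉X with T? (𝓛 (X ∪ ⁅ e ⁆))
  ... | yes Y∈𝓛 = toggle-∈ Y∈𝓛 X∈𝓛 (x∈p∪q⁺ (inj₂ (x∈⁅x⁆ e))) (remove-add e∉X)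
  ... | no  Y∉𝓛 = toggle-∉-fixed X∈𝓛 e∉X Y∉𝓛
  toggle-involutive e (X , X∈𝓛) | yes e∈X with T? (𝓛 (X - e))
  ... | yes Y∈𝓛 = toggle-∉ Y∈𝓛 X∈𝓛 (e∉X-e X e) (add-remove e∈X)
  ... | no  Y∉𝓛 = toggle-∈-fixed X∈𝓛 e∈X Y∉𝓛

  togglePerm : Fin n → Member 𝓛 ↔ Member 𝓛
  togglePerm e = mk↔ₛ′ (toggle e) (toggle e) (toggle-involutive e) (toggle-involutive e)

  ToggleGroup : Pred (Member 𝓛 ↔ Member 𝓛) 0ℓ
  ToggleGroup = Generated (Sym (Member 𝓛)) (λ π → ∃[ e ] π ≡ togglePerm e)

  ToggleAlternating : Set
  ToggleAlternating = Alternating (Member 𝓛) U.⊆ ToggleGroup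

  toggleImage : Fin n → Pred (Member 𝓛) 0ℓ → Pred (Member 𝓛) 0ℓ
  toggleImage e S Y = ∃[ X ] X U.∈ S × toggle e X ≡ Y

  -- For a subfamily 𝓢 of 𝓛:  𝓢 ∪ tₑ(𝓢) = 𝓛  and  𝓢 ∩ tₑ(𝓢) ≠ ∅,
  -- where tₑ is the toggle on 𝓛, not the one on 𝓢.
  record ToggleCovered (e : Fin n) (𝓢 : Family n) : Set where
    private
      S : Pred (Member 𝓛) 0ℓ
      S X = proj₁ X ∈ᶠ 𝓢
    field
      covers : Universal (S U.∪ toggleImage e S)
      meets  : Satisfiable (S U.∩ toggleImage e S)

  Essential : Pred (Fin n) 0ℓ
  Essential e = (∃[ X ] X ∈ᶠ 𝓛 × e ∈ X) × (∃[ Y ] Y ∈ᶠ 𝓛 × e ∉ Y)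

  Bundle : Pred (Subset n) 0ℓ
  Bundle Z = 1 < ∣ Z ∣ × (∀ {e W} → e ∈ Z → e ∈ W → W ∈ᶠ 𝓛 → Z ⊆ W)

  MaximalBundle : Pred (Subset n) 0ℓ
  MaximalBundle Z = Bundle Z × (∀ {Z′} → Bundle Z′ → Z ⊆ Z′ → Z′ ⊆ Z)

  -- The element z of a maximal bundle that is not excluded by the bundle
  -- rule may still be excluded by the first rule, namely when the bundle
  -- consists of elements lying in all, or in none, of the members of 𝓛.
  record IsEssentialization (𝓛′ : Family n) (E′ : Subset n) : Set where
    field
      essential : ∀ {e} → e ∈ E′ → Essential e
      bundled   : ∀ {Z} → MaximalBundle Z →
                  ∃[ z ] z ∈ Z × (∀ {e} → e ∈ Z → e ≢ z → e ∉ E′)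
                               × (Essential z → z ∈ E′)
      kept      : ∀ {e} → Essential e → (∀ {Z} → MaximalBundle Z → e ∉ Z) → e ∈ E′
      trace     : ∀ {X} → X ∈ᶠ 𝓛′ ⇔ (∃[ Y ] Y ∈ᶠ 𝓛 × X ≡ Y ∩ E′)

-- An essentialization is unique up to the choice of one element from each
-- maximal bundle.  In particular |E′| does not depend on the choice, and
-- neither does the existence of a suitable e ∈ E′, since the toggle of an
-- element of a bundle that is not constant on 𝓛 is the identity.
data InductivelyToggleAlternating {n} (𝓛 : Family n) : Set where
  small : ∀ {𝓛′ E′} → IsEssentialization 𝓛 𝓛′ E′ → ∣ E′ ∣ ≤ 4 →
          ToggleAlternating 𝓛 →
          InductivelyToggleAlternating 𝓛
  with-e : ∀ {𝓛′ E′ e} → IsEssentialization 𝓛 𝓛′ E′ → 5 ≤ ∣ E′ ∣ → e ∈ E′ →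
          InductivelyToggleAlternating (containing e 𝓛) →
          ToggleCovered 𝓛 e (containing e 𝓛) →
          InductivelyToggleAlternating 𝓛
  without-e : ∀ {𝓛′ E′ e} → IsEssentialization 𝓛 𝓛′ E′ → 5 ≤ ∣ E′ ∣ → e ∈ E′ →
          InductivelyToggleAlternating (avoiding e 𝓛) →
          ToggleCovered 𝓛 e (avoiding e 𝓛) →
          InductivelyToggleAlternating 𝓛

{-# OPTIONS --safe #-}

-- Let S be the chosen side of e, C the other side, t the toggle of e, p ∈ S a fixed
-- point of t, and G the toggle group.  The even permutations of S lift to G, and the
-- lifts act on C as well.  The set S₀ = {p} ∪ t(C) ⊆ S has |C| + 1 elements, so if
-- |C| ≥ 2 it has more even permutations than C has permutations, and a quotient h of
-- two lifts fixes C pointwise but moves a point of S₀; after a conjugation it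
-- moves p.  The supports of h and t h t⁻¹ meet only in p, hence their commutator is
-- a 3-cycle.  (If |C| = 1, lifts of 3-cycles of S are 3-cycles, and |E′| ≥ 5 rules
-- out |S| = 2.)  Lying in a common 3-cycle of G is an equivalence relation invariant
-- under G; it relates all of S, hence all of t(S), and p lies in both.  So G
-- contains all 3-cycles.
module Submission where

open import Defs
open import Algebra.Bundles using (Group)
open import Data.Bool.Base using (Bool; true; false; not; T)
open import Data.Bool.Properties using (T?; T-∧; ¬-not; not-¬) renaming (_≟_ to _≟ᵇ_)
open import Data.Fin.Base using (Fin; zero; suc; punchIn; combine; remQuot)
import Data.Fin.Permutation.Components as PC
open import Data.Fin.Permutation
  using (Permutation′; _⟨$⟩ʳ_; _⟨$⟩ˡ_; insert; remove; insert-punchIn; punchIn-permute; transpose; flip)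
  renaming (_≈_ to _≈ₚ_)
open import Data.Fin.Permutation.Transposition.List
  using (TranspositionList; eval; decompose; eval-decompose)
import Data.Fin.Properties as Fin
open import Data.Fin.Subset using (Subset; _∈_; _∉_; _∪_; _-_; ⁅_⁆; ∣_∣; inside; outside)
open import Data.Fin.Subset.Properties
  using (_∈?_; anySubset?; x∈⁅y⁆⇒x≡y; p⊂q⇒∣p∣<∣q∣; ∣⁅x⁆∣≡1; ∪-identityʳ; p─⊥≡p)
open import Data.List.Base using (List; []; _∷_; length; foldr)
open import Data.List.Relation.Unary.All using (All; []; _∷_)
open import Data.Nat.Base as ℕ using (ℕ; zero; suc; _!; _*_; z≤n; s≤s)
open import Data.Nat.Divisibility using (_∣_; divides; _∣0; ∣m∣n⇒∣m+n; ∣-refl)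
import Data.Nat.Properties as ℕ
open import Data.Product.Base using (∃-syntax; ∃₂; _×_; _,_; proj₁; proj₂; Σ-syntax)
open import Data.Sum.Base using (_⊎_; inj₁; inj₂)
open import Data.Sum.Function.Propositional using (_⊎-↔_)
open import Data.Vec.Base using ([]; _∷_; here; there; lookup; updateAt; tabulate)
open import Data.Vec.Properties
  using (lookup∘updateAt; lookup∘updateAt′; lookup∘tabulate; []=⇒lookup; lookup⇒[]=; ≡-dec)
open import Function.Base using (_∘_; case_of_)
open import Function.Bundles using (_↔_; Inverse; mk↔ₛ′; Equivalence)
open import Function.Construct.Composition using (_↔-∘_)
open import Function.Construct.Identity using (↔-id)
open import Function.Definitions using (Injective)
open import Level using (0ℓ)
open import Relation.Binary.Definitions using (DecidableEquality)
open import Relation.Binary.PropositionalEquality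
  using (_≡_; _≢_; refl; sym; trans; cong; cong₂; subst; subst₂; ≢-sym)
open import Relation.Nullary using (¬_; Dec; yes; no; does; contradiction; ¬?; _×-dec_)
open import Relation.Nullary.Decidable using (dec-true; dec-false; decidable-stable)
open import Relation.Unary as U using (Pred)

open Inverse using (to; from)

private
  variable
    n : ℕ

-- Counting permutations

encode : ∀ n → Permutation′ n → Fin (n !)
encode zero    π = zero
encode (suc n) π = combine (π ⟨$⟩ʳ zero) (encode n (remove zero π))

encode-injective : ∀ n {π ρ : Permutation′ n} → encode n π ≡ encode n ρ → π ≈ₚ ρ
encode-injective (suc n) {π} {ρ} eq with Fin.combine-injective (π ⟨$⟩ʳ zero) _ (ρ ⟨$⟩ʳ zero) _ eq
... | eq₀ , eq′ = λ where
  zero    → eq₀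
  (suc i) → trans (punchIn-permute π zero i)
           (trans (cong₂ punchIn eq₀ (encode-injective n {remove zero π} {remove zero ρ} eq′ i))
                  (sym (punchIn-permute ρ zero i)))

decode : ∀ n → Fin (n !) → Permutation′ n
decode zero    _ = ↔-id _
decode (suc n) i =
  insert zero (proj₁ (remQuot {suc n} (n !) i)) (decode n (proj₂ (remQuot {suc n} (n !) i)))

decode-injective : ∀ n {i j : Fin (n !)} → decode n i ≈ₚ decode n j → i ≡ j
decode-injective zero    {zero} {zero} _ = refl
decode-injective (suc n) {i} {j} eq =
  trans (sym (Fin.combine-remQuot {suc n} (n !) i))
 (trans (cong₂ combine (eq zero) (decode-injective n eq′))
        (Fin.combine-remQuot {suc n} (n !) j))
  where
  qi = proj₁ (remQuot {suc n} (n !) i)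
  qj = proj₁ (remQuot {suc n} (n !) j)
  πi = decode n (proj₂ (remQuot {suc n} (n !) i))
  πj = decode n (proj₂ (remQuot {suc n} (n !) j))
  eq′ : πi ≈ₚ πj
  eq′ k = Fin.punchIn-injective qi _ _
    (trans (sym (insert-punchIn zero qi πi k))
    (trans (eq (suc k))
    (trans (insert-punchIn zero qj πj k)
           (cong (λ q → punchIn q (πj ⟨$⟩ʳ k)) (sym (eq zero))))))

-- In the application `bit` records a parity correction and `res` the permutation that a lift
-- induces on C.
record Collision {m n} (bit : Permutation′ m → Fin 2) (res : Permutation′ m → Permutation′ n) : Set where
  field
    σ ρ   : Permutation′ m
    l     : Fin m
    σl≢ρl : σ ⟨$⟩ʳ l ≢ ρ ⟨$⟩ʳ l
    bit-≡ : bit σ ≡ bit ρ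
    res-≈ : res σ ≈ₚ res ρ

-- There are (k+2)! permutations of k+2 points, but only 2·(k+1)! values of (bit , res).
collision : ∀ {k} → 1 ℕ.≤ k → (bit : Permutation′ (2 ℕ.+ k) → Fin 2)
            (res : Permutation′ (2 ℕ.+ k) → Permutation′ (1 ℕ.+ k)) → Collision bit res
collision {k} 1≤k bit res = record
  { σ     = σ
  ; ρ     = ρ
  ; l     = proj₁ differ
  ; σl≢ρl = proj₂ differ
  ; bit-≡ = proj₁ same
  ; res-≈ = encode-injective _ {res σ} {res ρ} (proj₂ same)
  }
  where
  code : Permutation′ (2 ℕ.+ k) → Fin (2 * suc k !)
  code σ = combine (bit σ) (encode (suc k) (res σ))
  -- `1 ≤ k` enters as `2 < 2 + k`; multiplied by `suc k !`, this compares the number of codes with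
  -- `(2 + k) !`.
  twins = Fin.pigeonhole (ℕ.*-monoˡ-< (suc k !) {{suc k ℕ.!≢0}} (s≤s (s≤s 1≤k))) (code ∘ decode (2 ℕ.+ k))
  i<j = proj₁ (proj₂ (proj₂ twins))
  σ = decode (2 ℕ.+ k) (proj₁ twins)
  ρ = decode (2 ℕ.+ k) (proj₁ (proj₂ twins))
  differ = Fin.¬∀⟶∃¬ _ _ (λ l → (σ ⟨$⟩ʳ l) Fin.≟ (ρ ⟨$⟩ʳ l)) (Fin.<⇒≢ i<j ∘ decode-injective _)
  same = Fin.combine-injective (bit σ) _ (bit ρ) _ (proj₂ (proj₂ (proj₂ twins)))

-- Transpositions and 3-cycles

module _ {A : Set} where
  open Group (Sym A) using (_∙_; _⁻¹)

  perm-injective : (π : A ↔ A) → ∀ {x y} → to π x ≡ to π y → x ≡ y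
  perm-injective π {x} {y} eq =
    trans (sym (Inverse.inverseʳ π refl)) (Inverse.inverseʳ π eq)

  from-≡ : (π : A ↔ A) → ∀ {x y} → to π x ≡ y → from π y ≡ x
  from-≡ π eq = Inverse.inverseʳ π (sym eq)

  to-≡ : (π : A ↔ A) → ∀ {x y} → from π x ≡ y → to π y ≡ x
  to-≡ π eq = Inverse.inverseˡ π (sym eq)

  -- Distinctness of the three points is kept apart; `Tri` adds it.
  record Is3Cycle (π : A ↔ A) (a b c : A) : Set where
    constructor cycle
    field
      a↦b   : to π a ≡ b
      b↦c   : to π b ≡ c
      c↦a   : to π c ≡ a
      fixes : ∀ x → x ≢ a → x ≢ b → x ≢ c → to π x ≡ x

  open Is3Cycle

  rotate : ∀ {π a b c} → Is3Cycle π a b c → Is3Cycle π b c a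
  rotate (cycle p q r f) = cycle q r p (λ x x≢b x≢c x≢a → f x x≢a x≢b x≢c)

  reverse : ∀ {π a b c} → Is3Cycle π a b c → Is3Cycle (π ⁻¹) c b a
  reverse {π} (cycle p q r f) = cycle (from-≡ π q) (from-≡ π p) (from-≡ π r)
    (λ x x≢c x≢b x≢a → from-≡ π (f x x≢a x≢b x≢c))

  conjugate : ∀ {π a b c} ρ → Is3Cycle π a b c →
              Is3Cycle (ρ ∙ (π ∙ (ρ ⁻¹))) (to ρ a) (to ρ b) (to ρ c)
  conjugate {π} ρ (cycle p q r f) = cycle (move p) (move q) (move r)
    (λ x x≢a x≢b x≢c → trans
      (cong (to ρ) (f (from ρ x) (x≢a ∘ sym ∘ to-≡ ρ) (x≢b ∘ sym ∘ to-≡ ρ) (x≢c ∘ sym ∘ to-≡ ρ)))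
      (to-≡ ρ refl))
    where
    move : ∀ {x y} → to π x ≡ y → to ρ (to π (from ρ (to ρ x))) ≡ to ρ y
    move refl = cong (to ρ ∘ to π) (from-≡ ρ refl)

module Permutations {A : Set} (_≟_ : DecidableEquality A) where
  open Group (Sym A) using (_≈_; _∙_; ε; _⁻¹)

  transposeFun : A → A → A → A
  transposeFun a b x with x ≟ a | x ≟ b
  ... | yes _ | _     = b
  ... | no  _ | yes _ = a
  ... | no  _ | no  _ = x

  transposeFun-l : ∀ a b → transposeFun a b a ≡ b
  transposeFun-l a b with a ≟ a | a ≟ b
  ... | yes _  | _ = refl
  ... | no a≢a | _ = contradiction refl a≢a

  transposeFun-r : ∀ a b → transposeFun a b b ≡ a
  transposeFun-r a b with b ≟ a | b ≟ b
  ... | yes b≡a | _ = b≡a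
  ... | no _ | yes _ = refl
  ... | no _ | no b≢b = contradiction refl b≢b

  transposeFun-fixes : ∀ {a b} x → x ≢ a → x ≢ b → transposeFun a b x ≡ x
  transposeFun-fixes {a} {b} x x≢a x≢b with x ≟ a | x ≟ b
  ... | yes x≡a | _       = contradiction x≡a x≢a
  ... | no  _   | yes x≡b = contradiction x≡b x≢b
  ... | no  _   | no  _   = refl

  transposeFun-involutive : ∀ a b x → transposeFun a b (transposeFun a b x) ≡ x
  transposeFun-involutive a b x with x ≟ a | x ≟ b
  ... | yes refl | _        = transposeFun-r x b
  ... | no  _    | yes refl = transposeFun-l a x
  ... | no  x≢a  | no  x≢b  = transposeFun-fixes x x≢a x≢b

  transposition : A → A → A ↔ A
  transposition a b = mk↔ₛ′ (transposeFun a b) (transposeFun a b)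
    (transposeFun-involutive a b) (transposeFun-involutive a b)

  transposition-isTransposition : ∀ {a b} → a ≢ b → IsTransposition (transposition a b)
  transposition-isTransposition {a} {b} a≢b =
    a , b , a≢b , transposeFun-l a b , transposeFun-r a b , transposeFun-fixes

  Is3Cycle-unique : ∀ {π ρ a b c} → Is3Cycle π a b c → Is3Cycle ρ a b c → π ≈ ρ
  Is3Cycle-unique {π} {ρ} {a} {b} {c} (cycle p q r f) (cycle p′ q′ r′ f′) x
    with x ≟ a | x ≟ b | x ≟ c
  ... | yes refl | _ | _ = trans p (sym p′)
  ... | no _ | yes refl | _ = trans q (sym q′)
  ... | no _ | no _ | yes refl = trans r (sym r′)
  ... | no x≢a | no x≢b | no x≢c = trans (f x x≢a x≢b x≢c) (sym (f′ x x≢a x≢b x≢c))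

  -- Unlike `IsTransposition`, this names the two points, so that a point shared by two
  -- transpositions can be expressed.
  Swaps : A ↔ A → A → A → Set
  Swaps π a b = to π a ≡ b × to π b ≡ a × (∀ x → x ≢ a → x ≢ b → to π x ≡ x)

  transposition-swaps : ∀ a b → Swaps (transposition a b) a b
  transposition-swaps a b = transposeFun-l a b , transposeFun-r a b , transposeFun-fixes

  swaps-sym : ∀ {π a b} → Swaps π a b → Swaps π b a
  swaps-sym (p , q , f) = q , p , λ x x≢b x≢a → f x x≢a x≢b

  swaps-involutive : ∀ {π ρ a b} → Swaps π a b → Swaps ρ a b → ∀ x → to π (to ρ x) ≡ x
  swaps-involutive {π} {ρ} {a} {b} (p , q , f) (p′ , q′ , f′) x with x ≟ a | x ≟ b
  ... | yes refl | _ = trans (cong (to π) p′) q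
  ... | no _ | yes refl = trans (cong (to π) q′) p
  ... | no x≢a | no x≢b = trans (cong (to π) (f′ x x≢a x≢b)) (f x x≢a x≢b)

  swaps-3cycle : ∀ {π ρ a b c} → a ≢ b → a ≢ c → b ≢ c →
                 Swaps π a b → Swaps ρ a c → Is3Cycle (π ∙ ρ) a c b
  swaps-3cycle {π} {ρ} {a} {b} {c} a≢b a≢c b≢c (p , q , f) (p′ , q′ , f′) = cycle
    (trans (cong (to π) p′) (f c (≢-sym a≢c) (≢-sym b≢c)))
    (trans (cong (to π) q′) p)
    (trans (cong (to π) (f′ b (≢-sym a≢b) b≢c)) q)
    (λ x x≢a x≢c x≢b → trans (cong (to π) (f′ x x≢a x≢c)) (f x x≢a x≢b))

  3cycle-alternating : ∀ {a b c} → a ≢ b → a ≢ c → b ≢ c →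
    ∃[ π ] Alternating A π × Is3Cycle π a b c
  3cycle-alternating {a} {b} {c} a≢b a≢c b≢c = transposition a c ∙ transposition a b
    , (transposition a c ∷ transposition a b ∷ []
      , transposition-isTransposition a≢c ∷ transposition-isTransposition a≢b ∷ []
      , divides 1 refl , λ _ → refl)
    , swaps-3cycle {transposition a c} {transposition a b} a≢c a≢b (≢-sym b≢c)
        (transposition-swaps a c) (transposition-swaps a b)

-- 3-cycles in a generated group

module ThreeCycles {M : Set} (_≟_ : DecidableEquality M) (P : Pred (M ↔ M) 0ℓ) where
  open Group (Sym M) using (_≈_; _∙_; ε; _⁻¹)
  open Permutations _≟_

  G : Pred (M ↔ M) 0ℓ
  G = Generated (Sym M) P

  record Tri (a b c : M) : Set where
    constructor tri
    field
      {π}   : M ↔ M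
      π∈G   : G π
      a≢b   : a ≢ b
      a≢c   : a ≢ c
      b≢c   : b ≢ c
      is3Cycle : Is3Cycle π a b c

  Tri-rotate : ∀ {a b c} → Tri a b c → Tri b c a
  Tri-rotate (tri π∈G a≢b a≢c b≢c cyc) = tri π∈G b≢c (≢-sym a≢b) (≢-sym a≢c) (rotate cyc)

  Tri-reverse : ∀ {a b c} → Tri a b c → Tri c b a
  Tri-reverse (tri π∈G a≢b a≢c b≢c cyc) =
    tri (inv π∈G) (≢-sym b≢c) (≢-sym a≢c) (≢-sym a≢b) (reverse cyc)

  -- Rotation and reversal generate all reorderings of a triple, because the inverse of a 3-cycle is
  -- a 3-cycle run backwards.
  Tri-swapˡ : ∀ {a b c} → Tri a b c → Tri b a c
  Tri-swapˡ = Tri-rotate ∘ Tri-reverse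

  Tri-swapʳ : ∀ {a b c} → Tri a b c → Tri a c b
  Tri-swapʳ = Tri-reverse ∘ Tri-rotate

  Tri-conjugate : ∀ {ρ a b c} → G ρ → Tri a b c → Tri (to ρ a) (to ρ b) (to ρ c)
  Tri-conjugate {ρ} ρ∈G (tri π∈G a≢b a≢c b≢c cyc) =
    tri (mul ρ∈G (mul π∈G (inv ρ∈G)))
        (a≢b ∘ perm-injective ρ) (a≢c ∘ perm-injective ρ) (b≢c ∘ perm-injective ρ)
        (conjugate ρ cyc)

  -- The supports of α and β share only q, so β fixes `to α q` and α fixes `to β q`. Following q and
  -- these two points through β⁻¹, α⁻¹, β, α in turn shows that the commutator permutes them
  -- cyclically; elsewhere the two permutations do not interact.
  commutator : ∀ {α β q} → G α → G β → (∀ x → x ≢ q → to α x ≡ x ⊎ to β x ≡ x) →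
               to α q ≢ q → to β q ≢ q → Tri q (to α q) (to β q)
  commutator {α} {β} {q} α∈G β∈G disjoint αq≢q βq≢q =
    tri (mul α∈G (mul β∈G (mul (inv α∈G) (inv β∈G))))
        (≢-sym αq≢q) (≢-sym βq≢q) αq≢βq
        (cycle q↦αq αq↦βq βq↦q fix)
    where
    ω : M ↔ M
    ω = α ∙ (β ∙ ((α ⁻¹) ∙ (β ⁻¹)))

    chain : ∀ {x x₁ x₂ x₃ x₄} → from β x ≡ x₁ → from α x₁ ≡ x₂ → to β x₂ ≡ x₃ → to α x₃ ≡ x₄ →
            to ω x ≡ x₄
    chain refl refl refl refl = refl

    α-moves : ∀ {x} → x ≢ q → to α x ≢ x → to β x ≡ x
    α-moves {x} x≢q αx≢x with disjoint x x≢q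
    ... | inj₁ αx≡x = contradiction αx≡x αx≢x
    ... | inj₂ βx≡x = βx≡x

    β-moves : ∀ {x} → x ≢ q → to β x ≢ x → to α x ≡ x
    β-moves {x} x≢q βx≢x with disjoint x x≢q
    ... | inj₁ αx≡x = αx≡x
    ... | inj₂ βx≡x = contradiction βx≡x βx≢x

    αβq≡βq : to α (to β q) ≡ to β q
    αβq≡βq = β-moves βq≢q (βq≢q ∘ perm-injective β)

    βαq≡αq : to β (to α q) ≡ to α q
    βαq≡αq = α-moves αq≢q (αq≢q ∘ perm-injective α)

    αq≢βq : to α q ≢ to β q
    αq≢βq eq = αq≢q (perm-injective α (trans (cong (to α) eq) (trans αβq≡βq (sym eq))))

    back : ∀ (γ : M ↔ M) → to γ q ≢ q → from γ q ≢ q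
    back γ γq≢q eq = γq≢q (to-≡ γ eq)

    back-moves : ∀ (γ : M ↔ M) → to γ q ≢ q → to γ (from γ q) ≢ from γ q
    back-moves γ γq≢q eq = back γ γq≢q (trans (sym eq) (to-≡ γ refl))

    q↦αq : to ω q ≡ to α q
    q↦αq = chain refl (from-≡ α (β-moves (back β βq≢q) (back-moves β βq≢q))) (to-≡ β refl) refl

    αq↦βq : to ω (to α q) ≡ to β q
    αq↦βq = chain (from-≡ β βαq≡αq) (from-≡ α refl) refl αβq≡βq

    βq↦q : to ω (to β q) ≡ q
    βq↦q = chain (from-≡ β refl) refl (α-moves (back α αq≢q) (back-moves α αq≢q)) (to-≡ α refl)

    -- If α fixes x, it also fixes the point that β sends to x: this point is not q since
    -- `x ≢ to β q`, and should β fix it, it is x itself. The other case is symmetric.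
    fix : ∀ x → x ≢ q → x ≢ to α q → x ≢ to β q → to ω x ≡ x
    fix x x≢q x≢αq x≢βq with disjoint x x≢q
    ... | inj₁ αx≡x = chain refl (from-≡ α α-fixes) (to-≡ β refl) αx≡x
      where
      α-fixes : to α (from β x) ≡ from β x
      α-fixes with disjoint (from β x) (x≢βq ∘ sym ∘ to-≡ β)
      ... | inj₁ eq = eq
      ... | inj₂ eq = subst (λ y → to α y ≡ y) (trans (sym (to-≡ β refl)) eq) αx≡x
    ... | inj₂ βx≡x = chain (from-≡ β βx≡x) refl β-fixes (to-≡ α refl)
      where
      β-fixes : to β (from α x) ≡ from α x
      β-fixes with disjoint (from α x) (x≢αq ∘ sym ∘ to-≡ α)
      ... | inj₁ eq = subst (λ y → to β y ≡ y) (trans (sym (to-≡ α refl)) eq) βx≡x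
      ... | inj₂ eq = eq

  -- (y b a) composed with the inverse of (y c a) is (a c b).
  Tri-join₄ : ∀ {a b c y} → Tri a b y → Tri a c y → b ≢ c → Tri a b c
  Tri-join₄ {a} {b} {c} {y} aby acy b≢c = Tri-swapʳ (tri (mul π∈G (inv ρ∈G)) a≢c a≢b (≢-sym b≢c)
    (cycle (trans (cong (to π) (from-≡ ρ (b↦c cρ))) (fixes cπ c c≢y (≢-sym b≢c) (≢-sym a≢c)))
           (trans (cong (to π) (from-≡ ρ (a↦b cρ))) (a↦b cπ))
           (trans (cong (to π) (from-≡ ρ (fixes cρ b b≢y b≢c (≢-sym a≢b)))) (b↦c cπ))
           fix))
    where
    open Is3Cycle
    open Tri (Tri-reverse aby) using (π; π∈G) renaming (is3Cycle to cπ)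
    open Tri (Tri-reverse acy) using () renaming (π to ρ; π∈G to ρ∈G; is3Cycle to cρ)
    open Tri aby using (a≢b) renaming (a≢c to a≢y; b≢c to b≢y)
    open Tri acy using () renaming (a≢b to a≢c; b≢c to c≢y)

    fix : ∀ x → x ≢ a → x ≢ c → x ≢ b → to π (from ρ x) ≡ x
    fix x x≢a x≢c x≢b with x ≟ y
    ... | yes refl = trans (cong (to π) (from-≡ ρ (c↦a cρ))) (c↦a cπ)
    ... | no  x≢y  = trans (cong (to π) (from-≡ ρ (fixes cρ x x≢y x≢c x≢a))) (fixes cπ x x≢y x≢b x≢a)

  -- When `y ≡ c` or `z ≡ b` one of the given cycles already serves, and `y ≡ z` is the four-point
  -- case. Otherwise the two supports meet only in a, and the commutator of the cycles sends a to b,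
  -- b to c and c to a.
  Tri-join : ∀ {a b c y z} → Tri a b y → Tri a c z → b ≢ c → Tri a b c
  Tri-join {a} {b} {c} {y} {z} aby acz b≢c with y ≟ c | z ≟ b | y ≟ z
  ... | yes refl | _ | _ = aby
  ... | no _ | yes refl | _ = Tri-swapʳ acz
  ... | no _ | no _ | yes refl = Tri-join₄ aby acz b≢c
  ... | no y≢c | no z≢b | no y≢z =
    retarget (commutator {Tri.π aby} {Tri.π acz} {a} (Tri.π∈G aby) (Tri.π∈G acz) disjoint
      (a≢b ∘ sym ∘ trans (sym (a↦b cα)))
      (a≢c ∘ sym ∘ trans (sym (a↦b cβ))))
    where
    open Is3Cycle
    open Tri aby using (a≢b) renaming (is3Cycle to cα; a≢c to a≢y; b≢c to b≢y)
    open Tri acz using () renaming (is3Cycle to cβ; a≢b to a≢c; a≢c to a≢z; b≢c to c≢z)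
    retarget : Tri a (to (Tri.π aby) a) (to (Tri.π acz) a) → Tri a b c
    retarget t rewrite a↦b cα | a↦b cβ = t
    disjoint : ∀ x → x ≢ a → to (Tri.π aby) x ≡ x ⊎ to (Tri.π acz) x ≡ x
    disjoint x x≢a with x ≟ b | x ≟ y
    ... | yes refl | _ = inj₂ (fixes cβ x x≢a b≢c (≢-sym z≢b))
    ... | no _ | yes refl = inj₂ (fixes cβ x x≢a y≢c y≢z)
    ... | no x≢b | no x≢y = inj₁ (fixes cα x x≢a x≢b x≢y)

  Linked : M → M → Set
  Linked a b = a ≡ b ⊎ ∃[ c ] Tri a b c

  Linked-sym : ∀ {a b} → Linked a b → Linked b a
  Linked-sym (inj₁ a≡b)     = inj₁ (sym a≡b)
  Linked-sym (inj₂ (_ , t)) = inj₂ (_ , Tri-swapˡ t)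

  -- Both triples are reordered to start at the middle point b, where `Tri-join` applies.
  Linked-trans : ∀ {a b c} → Linked a b → Linked b c → Linked a c
  Linked-trans (inj₁ refl) l = l
  Linked-trans l (inj₁ refl) = l
  Linked-trans {a} {b} {c} (inj₂ (_ , t)) (inj₂ (_ , u)) with a ≟ c
  ... | yes a≡c = inj₁ a≡c
  ... | no  a≢c = inj₂ (_ , Tri-rotate (Tri-join (Tri-swapˡ t) u a≢c))

  Linked-conjugate : ∀ {ρ a b} → G ρ → Linked a b → Linked (to ρ a) (to ρ b)
  Linked-conjugate {ρ} ρ∈G (inj₁ a≡b) = inj₁ (cong (to ρ) a≡b)
  Linked-conjugate {ρ} ρ∈G (inj₂ (_ , t)) = inj₂ (_ , Tri-conjugate ρ∈G t)

  Linked⇒Tri : ∀ {a b c} → a ≢ b → a ≢ c → b ≢ c → Linked a b → Linked a c → Tri a b c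
  Linked⇒Tri a≢b a≢c b≢c (inj₁ a≡b) _ = contradiction a≡b a≢b
  Linked⇒Tri a≢b a≢c b≢c (inj₂ _) (inj₁ a≡c) = contradiction a≡c a≢c
  Linked⇒Tri a≢b a≢c b≢c (inj₂ (_ , t)) (inj₂ (_ , u)) = Tri-join t u b≢c

  -- An even product of transpositions is consumed two factors at a time. Two factors with a common
  -- point multiply to the identity or to a 3-cycle, and every 3-cycle lies in `G` when all points
  -- are linked.
  linked⇒alternating : (∀ a b → Linked a b) → Alternating M U.⊆ G
  linked⇒alternating linked {π} (τs , ts , even , eq) = resp {x = foldr _∙_ ε τs} eq (products τs ts even)
    where
    adjacent : ∀ {σ τ a b c} → a ≢ b → a ≢ c → Swaps σ a b → Swaps τ a c → G (σ ∙ τ)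
    adjacent {σ} {τ} {a} {b} {c} a≢b a≢c s t with b ≟ c
    ... | yes refl = resp {x = ε} {y = σ ∙ τ} (λ x → sym (swaps-involutive {σ} {τ} s t x)) unit
    ... | no  b≢c  = resp {y = σ ∙ τ} (Is3Cycle-unique cyc (swaps-3cycle {σ} {τ} a≢b a≢c b≢c s t)) π∈G
      where open Tri (Linked⇒Tri a≢c a≢b (≢-sym b≢c) (linked a c) (linked a b))
              using (π∈G) renaming (is3Cycle to cyc)

    pair : ∀ {σ τ} → IsTransposition σ → IsTransposition τ → G (σ ∙ τ)
    pair {σ} {τ} (a , b , a≢b , s) (c , d , c≢d , t) with a ≟ c
    ... | yes refl = adjacent {σ} {τ} a≢b c≢d s t
    -- Inserting `μ ∙ μ`, which is the identity, splits the product into two pairs with a common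
    -- point: a for σ and μ, c for μ and τ.
    ... | no  a≢c  = resp {x = (σ ∙ μ) ∙ (μ ∙ τ)} {y = σ ∙ τ}
                       (λ x → cong (to σ) (transposeFun-involutive a c (to τ x)))
                       (mul (adjacent {σ} {μ} a≢b a≢c s (transposition-swaps a c))
                            (adjacent {μ} {τ} (≢-sym a≢c) c≢d (swaps-sym {μ} (transposition-swaps a c)) t))
      where μ = transposition a c

    products : ∀ τs → All IsTransposition τs → 2 ∣ length τs → G (foldr _∙_ ε τs)
    products []           _              _ = unit
    products (_ ∷ [])     _              (divides (suc _) ())
    products (σ ∷ τ ∷ τs) (s ∷ t ∷ ts) (divides (suc q) eq) =
      resp {x = (σ ∙ τ) ∙ foldr _∙_ ε τs} (λ _ → refl)
           (mul (pair {σ} {τ} s t) (products τs ts (divides q (cong (ℕ.pred ∘ ℕ.pred) eq))))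

-- Even permutations with prescribed action on finitely many points

parity : ∀ n → (2 ∣ n) ⊎ (2 ∣ suc n)
parity zero    = inj₁ (2 ∣0)
parity (suc n) with parity n
... | inj₁ 2∣n   = inj₂ (∣m∣n⇒∣m+n ∣-refl 2∣n)
... | inj₂ 2∣1+n = inj₁ 2∣1+n

PC-transpose-same : ∀ {k} (i j : Fin k) → PC.transpose i i j ≡ j
PC-transpose-same i j with j Fin.≟ i
... | yes j≡i = sym j≡i
... | no  j≢i with j Fin.≟ i
...   | yes j≡i = sym j≡i
...   | no  _   = refl

-- The head of a `TranspositionList` acts first under `eval`, but last under `foldr _∙_ ε`. The
-- product therefore matches the inverse of `eval`, and σ has to be decomposed through `flip σ`.
from-flip : ∀ {n} {π ρ : Permutation′ n} → π ≈ₚ flip ρ → ∀ i → π ⟨$⟩ˡ i ≡ ρ ⟨$⟩ʳ i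
from-flip {π = π} {ρ} eq i = from-≡ π {ρ ⟨$⟩ʳ i} {i} (trans (eq (ρ ⟨$⟩ʳ i)) (from-≡ ρ refl))

module EvenExtension {A : Set} (_≟_ : DecidableEquality A) {k : ℕ} (φ : Fin (2 ℕ.+ k) → A)
                     (φ-injective : Injective _≡_ _≡_ φ) where
  open Group (Sym A) using (_≈_; _∙_; ε; _⁻¹)
  open Permutations _≟_

  transposition-φ : ∀ i j l → to (transposition (φ i) (φ j)) (φ l) ≡ φ (PC.transpose j i l)
  transposition-φ i j l with l Fin.≟ j
  ... | yes refl = transposeFun-r (φ i) (φ l)
  ... | no  l≢j with l Fin.≟ i
  ...   | yes refl = transposeFun-l (φ l) (φ j)
  ...   | no  l≢i  = transposeFun-fixes (φ l) (l≢i ∘ φ-injective) (l≢j ∘ φ-injective)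

  Local : A ↔ A → Set
  Local π = ∀ a → (∀ l → a ≢ φ l) → to π a ≡ a

  Along : A ↔ A → (Fin (2 ℕ.+ k) → Fin (2 ℕ.+ k)) → Set
  Along π f = ∀ l → to π (φ l) ≡ φ (f l)

  transposition-local : ∀ i j → Local (transposition (φ i) (φ j))
  transposition-local i j a a∉φ = transposeFun-fixes a (a∉φ i) (a∉φ j)

  transpositions : (xs : TranspositionList (2 ℕ.+ k)) →
    ∃[ τs ] All IsTransposition τs × Along (foldr _∙_ ε τs) (eval xs ⟨$⟩ˡ_) × Local (foldr _∙_ ε τs)
  transpositions [] = [] , [] , (λ _ → refl) , (λ _ _ → refl)
  transpositions ((i , j) ∷ xs) with i Fin.≟ j | transpositions xs
  -- A pair `(i , i)` acts as the identity and is not an `IsTransposition`, so it adds nothing to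
  -- the product.
  ... | yes refl | τs , ts , along , local =
    τs , ts , (λ l → trans (along l) (cong φ (sym (PC-transpose-same i (eval xs ⟨$⟩ˡ l))))) , local
  ... | no i≢j | τs , ts , along , local =
      transposition (φ i) (φ j) ∷ τs
    , transposition-isTransposition (i≢j ∘ φ-injective) ∷ ts
    , (λ l → trans (cong (to (transposition (φ i) (φ j))) (along l)) (transposition-φ i j (eval xs ⟨$⟩ˡ l)))
    , (λ a a∉φ → trans (cong (to (transposition (φ i) (φ j))) (local a a∉φ)) (transposition-local i j a a∉φ))

  -- An odd permutation is made even by afterwards swapping the first two points. The bit remembers
  -- whether this happened, so that two permutations with equal bits are altered in the same way.
  evenCorrection : Fin 2 → Fin (2 ℕ.+ k) → Fin (2 ℕ.+ k)
  evenCorrection zero       = λ l → l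
  evenCorrection (suc zero) = PC.transpose (suc zero) zero

  evenCorrection-injective : ∀ b → Injective _≡_ _≡_ (evenCorrection b)
  evenCorrection-injective zero       eq = eq
  evenCorrection-injective (suc zero) eq = perm-injective (transpose (suc zero) zero) eq

  record Extension (σ : Permutation′ (2 ℕ.+ k)) : Set where
    field
      bit         : Fin 2
      π           : A ↔ A
      alternating : Alternating A π
      along       : Along π (evenCorrection bit ∘ (σ ⟨$⟩ʳ_))
      local       : Local π

  extend : ∀ {σ f} → (∀ l → f l ≡ σ ⟨$⟩ʳ l) →
           (∃[ τs ] All IsTransposition τs × Along (foldr _∙_ ε τs) f × Local (foldr _∙_ ε τs)) →
           Extension σ
  extend {σ} f≗σ (τs , ts , along , local) with parity (length τs)
  ... | inj₁ even = record
    { bit         = zero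
    ; π           = foldr _∙_ ε τs
    ; alternating = τs , ts , even , λ _ → refl
    ; along       = λ l → trans (along l) (cong φ (f≗σ l))
    ; local       = local
    }
  ... | inj₂ odd = record
    { bit         = suc zero
    ; π           = τ ∙ foldr _∙_ ε τs
    ; alternating = τ ∷ τs
                  , transposition-isTransposition (λ eq → case φ-injective eq of λ ()) ∷ ts
                  , odd , λ _ → refl
    ; along       = λ l → trans (cong (to τ) (trans (along l) (cong φ (f≗σ l))))
                                (transposition-φ zero (suc zero) (σ ⟨$⟩ʳ l))
    ; local       = λ a a∉φ → trans (cong (to τ) (local a a∉φ)) (transposition-local zero (suc zero) a a∉φ)
    }
    where
    τ : A ↔ A
    τ = transposition (φ zero) (φ (suc zero))

  extension : ∀ σ → Extension σ
  extension σ = extend {f = eval (decompose (flip σ)) ⟨$⟩ˡ_}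
    (from-flip {π = eval (decompose (flip σ))} {σ} (eval-decompose (flip σ)))
    (transpositions (decompose (flip σ)))

-- The group-theoretic core

-- In the terms of the overview, `ι` embeds the side S, `κ` lists the `suc k` elements of C, and
-- `r i` is the partner in S of `κ i` under t. The parameter `third` serves the case |C| = 1.
module Covering
  {M A : Set} (_≟ₘ_ : DecidableEquality M) (_≟_ : DecidableEquality A) (P : Pred (M ↔ M) 0ℓ) {k : ℕ}
  (ι : A → M) (ι-injective : Injective _≡_ _≡_ ι)
  (κ : Fin (suc k) → M) (κ-injective : Injective _≡_ _≡_ κ)
  (split : ∀ m → (∃[ a ] ι a ≡ m) ⊎ (∃[ i ] κ i ≡ m)) (ι≢κ : ∀ {a i} → ι a ≢ κ i)
  (lift : ∀ {π} → Alternating A π → ∃[ h ] Generated (Sym M) P h × (∀ a → to h (ι a) ≡ ι (to π a)))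
  {t : M ↔ M} (t∈G : Generated (Sym M) P t)
  {p : A} (tp≡p : to t (ι p) ≡ ι p)
  (r : Fin (suc k) → A) (tr≡κ : ∀ i → to t (ι (r i)) ≡ κ i) (tκ≡r : ∀ i → to t (κ i) ≡ ι (r i))
  (third : k ≡ 0 → ∀ a → ∃[ z ] z ≢ p × z ≢ a)
  where
  open Group (Sym M) using (_∙_; _⁻¹)
  open Group (Sym A) using () renaming (_∙_ to _∙ᴬ_; _⁻¹ to _⁻¹ᴬ)
  open ThreeCycles _≟ₘ_ P
  open Permutations _≟_ using (3cycle-alternating)

  -- This lists the set S₀ of the overview, p first and then t(C).
  φ : Fin (2 ℕ.+ k) → A
  φ zero    = p
  φ (suc i) = r i

  p≢r : ∀ i → p ≢ r i
  p≢r i refl = ι≢κ (trans (sym tp≡p) (tr≡κ i))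

  φ-injective : Injective _≡_ _≡_ φ
  φ-injective {zero}  {zero}  eq = refl
  φ-injective {zero}  {suc j} eq = contradiction eq (p≢r j)
  φ-injective {suc i} {zero}  eq = contradiction (sym eq) (p≢r i)
  φ-injective {suc i} {suc j} eq =
    cong suc (κ-injective (trans (sym (tr≡κ i)) (trans (cong (to t ∘ ι) eq) (tr≡κ j))))

  open EvenExtension _≟_ φ φ-injective

  Extends : M ↔ M → A ↔ A → Set
  Extends h π = ∀ a → to h (ι a) ≡ ι (to π a)

  extends-inv : ∀ {h π} → Extends h π → Extends (h ⁻¹) (π ⁻¹ᴬ)
  extends-inv {h} {π} ext a = from-≡ h (trans (ext (from π a)) (cong ι (to-≡ π refl)))

  extends-∙ : ∀ {g h ρ π} → Extends g ρ → Extends h π → Extends (g ∙ h) (ρ ∙ᴬ π)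
  extends-∙ {g} {π = π} ext ext′ a = trans (cong (to g) (ext′ a)) (ext (to π a))

  -- Since h permutes the image of `ι` through the bijection π, injectivity leaves no point of that
  -- image for `κ i` to be sent to.
  preserves : ∀ {h π} → Extends h π → ∀ i → ∃[ j ] to h (κ i) ≡ κ j
  preserves {h} {π} ext i with split (to h (κ i))
  ... | inj₂ (j , κj≡) = j , sym κj≡
  ... | inj₁ (a , ιa≡) = contradiction
    (perm-injective h (trans (ext (from π a)) (trans (cong ι (to-≡ π refl)) ιa≡))) ι≢κ

  restrict : ∀ {h π} → Extends h π → Permutation′ (suc k)
  restrict {h} {π} ext = mk↔ₛ′ (proj₁ ∘ f) (proj₁ ∘ f⁻¹)
    (λ i → κ-injective (trans (sym (proj₂ (f (proj₁ (f⁻¹ i))))) (to-≡ h (proj₂ (f⁻¹ i)))))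
    (λ i → κ-injective (trans (sym (proj₂ (f⁻¹ (proj₁ (f i))))) (from-≡ h (proj₂ (f i)))))
    where
    f   = preserves {h} {π} ext
    f⁻¹ = preserves {h ⁻¹} {π ⁻¹ᴬ} (extends-inv {h} {π} ext)

  -- The field `local` confines the action of h on S to S₀; this is what later separates the support
  -- of h from that of its conjugate by t.
  record Mover (a : A) : Set where
    field
      h       : M ↔ M
      π       : A ↔ A
      h∈G     : G h
      extends : Extends h π
      fixes-κ : ∀ i → to h (κ i) ≡ κ i
      local   : Local π
      moves   : to π a ≢ a

  -- The two lifts agree on C, so their quotient is trivial there. Equal bits mean that σ and ρ
  -- received the same injective correction, so their disagreement at l survives and the quotient
  -- moves `φ l`.
  quotient-mover : ∀ {σ ρ l} (Eσ : Extension σ) (Eρ : Extension ρ) →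
    Extension.bit Eσ ≡ Extension.bit Eρ → σ ⟨$⟩ʳ l ≢ ρ ⟨$⟩ʳ l →
    ∀ {hσ hρ} → G hσ → G hρ → Extends hσ (Extension.π Eσ) → Extends hρ (Extension.π Eρ) →
    (∀ i → to hσ (κ i) ≡ to hρ (κ i)) →
    Mover (φ l)
  quotient-mover {σ} {ρ} {l} Eσ Eρ sameBit σl≢ρl {hσ} {hρ} hσ∈G hρ∈G extσ extρ same = record
    { h       = (hρ ⁻¹) ∙ hσ
    ; π       = (Eρ.π ⁻¹ᴬ) ∙ᴬ Eσ.π
    ; h∈G     = mul (inv hρ∈G) hσ∈G
    ; extends = extends-∙ {hρ ⁻¹} {hσ} {Eρ.π ⁻¹ᴬ} {Eσ.π} (extends-inv {hρ} {Eρ.π} extρ) extσ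
    ; fixes-κ = λ m → from-≡ hρ (sym (same m))
    ; local   = λ a a∉φ → from-≡ Eρ.π (trans (Eρ.local a a∉φ) (sym (Eσ.local a a∉φ)))
    ; moves   = λ fixed → σl≢ρl (evenCorrection-injective Eσ.bit (φ-injective
                  (trans (sym (Eσ.along l)) (trans (sym (to-≡ Eρ.π fixed))
                    (trans (Eρ.along l) (cong (λ b → φ (evenCorrection b (ρ ⟨$⟩ʳ l))) (sym sameBit)))))))
    }
    where
    module Eσ = Extension Eσ
    module Eρ = Extension Eρ

  even : Permutation′ (2 ℕ.+ k) → A ↔ A
  even σ = Extension.π (extension σ)

  lifted : Permutation′ (2 ℕ.+ k) → M ↔ M
  lifted σ = proj₁ (lift {even σ} (Extension.alternating (extension σ)))

  lifted∈G : ∀ σ → G (lifted σ)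
  lifted∈G σ = proj₁ (proj₂ (lift {even σ} (Extension.alternating (extension σ))))

  lifted-extends : ∀ σ → Extends (lifted σ) (even σ)
  lifted-extends σ = proj₂ (proj₂ (lift {even σ} (Extension.alternating (extension σ))))

  restricted : Permutation′ (2 ℕ.+ k) → Permutation′ (1 ℕ.+ k)
  restricted σ = restrict {lifted σ} {even σ} (lifted-extends σ)

  collision-mover : Collision (Extension.bit ∘ extension) restricted → ∃[ l ] Mover (φ l)
  collision-mover col = l ,
    quotient-mover {σ} {ρ} {l} (extension σ) (extension ρ) bit-≡ σl≢ρl
      {lifted σ} {lifted ρ} (lifted∈G σ) (lifted∈G ρ) (lifted-extends σ) (lifted-extends ρ)
      (λ i → trans (proj₂ (preserves {lifted σ} {even σ} (lifted-extends σ) i))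
             (trans (cong κ (res-≈ i)) (sym (proj₂ (preserves {lifted ρ} {even ρ} (lifted-extends ρ) i)))))
    where open Collision {bit = Extension.bit ∘ extension} {restricted} col

  mover : 1 ℕ.≤ k → ∃[ l ] Mover (φ l)
  mover 1≤k = collision-mover (collision 1≤k (Extension.bit ∘ extension) restricted)

  another : ∀ {n} → 1 ℕ.≤ n → (i : Fin (suc n)) → ∃[ j ] j ≢ i
  another (s≤s _) zero    = suc zero , λ ()
  another (s≤s _) (suc i) = zero , λ ()

  -- The lift g permutes C, so the conjugate still fixes C pointwise; γ is trivial off S₀, so the
  -- action on S stays within S₀.
  conjugate-mover : ∀ {g γ a} → G g → Extends g γ → (∀ b → (∀ l → b ≢ φ l) → to γ b ≡ b) →
                    Mover a → Mover (to γ a)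
  conjugate-mover {g} {γ} {a} g∈G g-ext γ-local μ = record
    { h       = g ∙ (h ∙ (g ⁻¹))
    ; π       = γ ∙ᴬ (π ∙ᴬ (γ ⁻¹ᴬ))
    ; h∈G     = mul g∈G (mul h∈G (inv g∈G))
    ; extends = extends-∙ {g} {h ∙ (g ⁻¹)} {γ} {π ∙ᴬ (γ ⁻¹ᴬ)} g-ext
                  (extends-∙ {h} {g ⁻¹} {π} {γ ⁻¹ᴬ} extends g⁻¹-ext)
    ; fixes-κ = λ m → trans (cong (to g) (trans (cong (to h) (proj₂ (g⁻¹-κ m)))
                        (trans (fixes-κ _) (sym (proj₂ (g⁻¹-κ m)))))) (to-≡ g refl)
    ; local   = λ b b∉φ → trans (cong (to γ) (trans (cong (to π) (from-≡ γ (γ-local b b∉φ))) (local b b∉φ)))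
                                (γ-local b b∉φ)
    ; moves   = λ eq → moves (perm-injective γ (trans (cong (to γ ∘ to π) (sym (from-≡ γ refl))) eq))
    }
    where
    open Mover μ
    g⁻¹-ext : Extends (g ⁻¹) (γ ⁻¹ᴬ)
    g⁻¹-ext = extends-inv {g} {γ} g-ext
    g⁻¹-κ : ∀ i → ∃[ j ] from g (κ i) ≡ κ j
    g⁻¹-κ = preserves {g ⁻¹} {γ ⁻¹ᴬ} g⁻¹-ext

  -- A point `r i` is brought to p by the 3-cycle `r i`, p, `r j`, which is even and hence has a
  -- lift. The third point is chosen in S₀ to keep the conjugate local, and `1 ≤ k` supplies it.
  mover-at-p : 1 ℕ.≤ k → ∃[ l ] Mover (φ l) → Mover p
  mover-at-p 1≤k (zero  , μ) = μ
  mover-at-p 1≤k (suc i , μ) =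
    let j , j≢i = another 1≤k i
        ri≢rj = j≢i ∘ sym ∘ Fin.suc-injective ∘ φ-injective
        γ , γ-alt , γ-cycle = 3cycle-alternating (≢-sym (p≢r i)) ri≢rj (p≢r j)
        g , g∈G , g-ext = lift {γ} γ-alt
    in subst Mover (Is3Cycle.a↦b γ-cycle) (conjugate-mover {g} {γ} g∈G g-ext
         (λ b b∉φ → Is3Cycle.fixes γ-cycle b (b∉φ (suc i)) (b∉φ zero) (b∉φ (suc j))) μ)

  mover-p : 1 ℕ.≤ k → Mover p
  mover-p 1≤k = mover-at-p 1≤k (mover 1≤k)

  -- The supports of h and of its conjugate by t meet only in p.
  mover-tri : Mover p → ∃₂ λ x m → Tri (ι p) (ι x) m
  mover-tri μ = to π p , to hᵗ (ι p) , subst (λ y → Tri (ι p) y (to hᵗ (ι p))) (extends p)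
    (commutator {h} {hᵗ} h∈G (mul t∈G (mul h∈G (inv t∈G))) disjoint hp≢p hᵗp≢p)
    where
    open Mover μ

    hᵗ : M ↔ M
    hᵗ = t ∙ (h ∙ (t ⁻¹))

    hp≢p : to h (ι p) ≢ ι p
    hp≢p eq = moves (ι-injective (trans (sym (extends p)) eq))

    hᵗp≢p : to hᵗ (ι p) ≢ ι p
    hᵗp≢p eq = hp≢p (perm-injective t (trans (cong (to t ∘ to h) (sym (from-≡ t tp≡p)))
                                     (trans eq (sym tp≡p))))

    disjoint : ∀ m → m ≢ ι p → to h m ≡ m ⊎ to hᵗ m ≡ m
    disjoint m m≢p with split m
    ... | inj₂ (i , refl) = inj₁ (fixes-κ i)
    ... | inj₁ (a , refl) with Fin.any? (λ i → r i ≟ a)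
    -- A point of t(C) is carried by t into C, where h is trivial, so the conjugate fixes it. A
    -- point of S outside S₀ is fixed by h itself.
    ...   | yes (i , refl) = inj₂
      (trans (cong (to t) (trans (cong (to h) (from-≡ t (tκ≡r i))) (fixes-κ i))) (tκ≡r i))
    ...   | no  a∉r = inj₁ (trans (extends a) (cong ι (local a λ where
              zero    a≡p → m≢p (cong ι a≡p)
              (suc i) a≡r → a∉r (i , sym a≡r))))

  -- A lift maps C to itself, so it fixes the only point of C; the lift of a 3-cycle of S is then a
  -- 3-cycle on the same points.
  singleton-tri : k ≡ 0 → ∀ {a b c} → a ≢ b → a ≢ c → b ≢ c → Tri (ι a) (ι b) (ι c)
  singleton-tri refl {a} {b} {c} a≢b a≢c b≢c =
    tri {π = g} g∈G (a≢b ∘ ι-injective) (a≢c ∘ ι-injective) (b≢c ∘ ι-injective)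
      (cycle (trans (ext a) (cong ι (Is3Cycle.a↦b γ-cycle)))
             (trans (ext b) (cong ι (Is3Cycle.b↦c γ-cycle)))
             (trans (ext c) (cong ι (Is3Cycle.c↦a γ-cycle))) fix)
    where
    3cyc : ∃[ γ ] Alternating A γ × Is3Cycle γ a b c
    3cyc = 3cycle-alternating a≢b a≢c b≢c
    γ = proj₁ 3cyc
    γ-cycle : Is3Cycle γ a b c
    γ-cycle = proj₂ (proj₂ 3cyc)
    lifted-γ : ∃[ h ] G h × Extends h γ
    lifted-γ = lift {γ} (proj₁ (proj₂ 3cyc))
    g = proj₁ lifted-γ
    g∈G = proj₁ (proj₂ lifted-γ)
    ext : Extends g γ
    ext = proj₂ (proj₂ lifted-γ)

    fix : ∀ m → m ≢ ι a → m ≢ ι b → m ≢ ι c → to g m ≡ m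
    fix m m≢a m≢b m≢c with split m
    ... | inj₁ (x , refl) =
      trans (ext x) (cong ι (Is3Cycle.fixes γ-cycle x (m≢a ∘ cong ι) (m≢b ∘ cong ι) (m≢c ∘ cong ι)))
    ... | inj₂ (zero , refl) with preserves {g} {γ} ext zero
    ...   | zero , eq = eq

  -- Conjugating the given cycle by a lift of the 3-cycle p, x, a replaces p by x and x by a. This
  -- links x to a, and p is already linked to x.
  tri⇒linked : ∀ {x m} → Tri (ι p) (ι x) m → ∀ a → p ≢ a → Linked (ι p) (ι a)
  tri⇒linked {x} {m} pxm a p≢a with x ≟ a
  ... | yes refl = inj₂ (m , pxm)
  ... | no  x≢a  = Linked-trans (inj₂ (m , pxm))
    (let γ , γ-alt , γ-cycle = 3cycle-alternating (Tri.a≢b pxm ∘ cong ι) p≢a x≢a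
         g , g∈G , ext = lift {γ} γ-alt
     in inj₂ (to g m , subst₂ (λ y z → Tri y z (to g m))
               (trans (ext p) (cong ι (Is3Cycle.a↦b γ-cycle)))
               (trans (ext x) (cong ι (Is3Cycle.b↦c γ-cycle)))
               (Tri-conjugate {g} g∈G pxm)))

  linked-ι : ∀ a → Linked (ι p) (ι a)
  linked-ι a with p ≟ a
  ... | yes p≡a = inj₁ (cong ι p≡a)
  ... | no  p≢a with 1 ℕ.≤? k
  ...   | no 1≰k =
    let k≡0 = ℕ.n<1⇒n≡0 (ℕ.≰⇒> 1≰k)
        z , z≢p , z≢a = third k≡0 a
    in inj₂ (ι z , singleton-tri k≡0 p≢a (≢-sym z≢p) (≢-sym z≢a))
  ...   | yes 1≤k =
    let x , m , pxm = mover-tri (mover-p 1≤k)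
    in tri⇒linked pxm a p≢a

  -- A point of C is t(`r i`), and t fixes p, so applying t to the link between p and `r i` reaches
  -- it.
  linked-p : ∀ m → Linked (ι p) m
  linked-p m with split m
  ... | inj₁ (a , refl) = linked-ι a
  ... | inj₂ (i , refl) = subst₂ Linked tp≡p (tr≡κ i) (Linked-conjugate {t} t∈G (linked-ι (r i)))

  alternating⊆G : Alternating M U.⊆ G
  alternating⊆G {π} = linked⇒alternating (λ a b → Linked-trans (Linked-sym (linked-p a)) (linked-p b)) {π}

-- Toggles

infix 4 _≟ᵐ_

_≟ᵐ_ : {𝓛 : Family n} → DecidableEquality (Member 𝓛)
X ≟ᵐ Y with ≡-dec _≟ᵇ_ (proj₁ X) (proj₁ Y)
... | yes eq = yes (Member-≡ eq)
... | no  ne = no (ne ∘ cong proj₁)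

Member-∷ : (𝓛 : Family (suc n)) →
           (Member (𝓛 ∘ (inside ∷_)) ⊎ Member (𝓛 ∘ (outside ∷_))) ↔ Member 𝓛
Member-∷ 𝓛 = mk↔ₛ′
  (λ { (inj₁ (X , X∈)) → inside ∷ X , X∈ ; (inj₂ (X , X∈)) → outside ∷ X , X∈ })
  (λ { (inside ∷ X , X∈) → inj₁ (X , X∈) ; (outside ∷ X , X∈) → inj₂ (X , X∈) })
  (λ { (inside ∷ X , X∈) → refl ; (outside ∷ X , X∈) → refl })
  (λ { (inj₁ _) → refl ; (inj₂ _) → refl })

Member-finite : (𝓛 : Family n) → ∃[ m ] Fin m ↔ Member 𝓛
Member-finite {zero} 𝓛 with T? (𝓛 [])
... | yes []∈ = 1 , mk↔ₛ′ (λ _ → [] , []∈) (λ _ → zero)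
                      (λ { ([] , _) → Member-≡ refl }) (λ { zero → refl })
... | no  []∉ = 0 , mk↔ₛ′ (λ ()) (λ { ([] , []∈) → contradiction []∈ []∉ })
                      (λ { ([] , []∈) → contradiction []∈ []∉ }) (λ ())
Member-finite {suc n} 𝓛 with Member-finite (𝓛 ∘ (inside ∷_)) | Member-finite (𝓛 ∘ (outside ∷_))
... | m₁ , enum₁ | m₂ , enum₂ = m₁ ℕ.+ m₂ , Member-∷ 𝓛 ↔-∘ ((enum₁ ⊎-↔ enum₂) ↔-∘ Fin.+↔⊎)

∉⇒lookup : {X : Subset n} {e : Fin n} → e ∉ X → lookup X e ≡ outside
∉⇒lookup e∉X = ¬-not (e∉X ∘ lookup⇒[]= _ _)

lookup⇒∉ : {X : Subset n} {e : Fin n} → lookup X e ≡ outside → e ∉ X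
lookup⇒∉ eq e∈X = case trans (sym ([]=⇒lookup e∈X)) eq of λ ()

-- Adding and removing an element become one operation, which spares the case distinction on
-- membership.
flipAt : Fin n → Subset n → Subset n
flipAt e X = updateAt X e not

∪-flipAt : {X : Subset n} {e : Fin n} → e ∉ X → X ∪ ⁅ e ⁆ ≡ flipAt e X
∪-flipAt {X = inside  ∷ X} {zero}  e∉X = contradiction here e∉X
∪-flipAt {X = outside ∷ X} {zero}  e∉X = cong (inside ∷_) (∪-identityʳ X)
∪-flipAt {X = inside  ∷ X} {suc e} e∉X = cong (inside ∷_) (∪-flipAt (e∉X ∘ there))
∪-flipAt {X = outside ∷ X} {suc e} e∉X = cong (outside ∷_) (∪-flipAt (e∉X ∘ there))

─-flipAt : {X : Subset n} {e : Fin n} → e ∈ X → X - e ≡ flipAt e X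
─-flipAt {X = _ ∷ X}       here        = cong (outside ∷_) (p─⊥≡p X)
─-flipAt {X = inside  ∷ X} (there e∈X) = cong (inside ∷_) (─-flipAt e∈X)
─-flipAt {X = outside ∷ X} (there e∈X) = cong (outside ∷_) (─-flipAt e∈X)

module _ (𝓛 : Family n) where

  toggle-flips : ∀ {e X} (X∈𝓛 : X ∈ᶠ 𝓛) (Y∈𝓛 : flipAt e X ∈ᶠ 𝓛) →
                 toggle 𝓛 e (X , X∈𝓛) ≡ (flipAt e X , Y∈𝓛)
  toggle-flips {e} {X} X∈𝓛 Y∈𝓛 = case e ∈? X of λ where
    (yes e∈X) → toggle-∈ 𝓛 X∈𝓛 Y∈𝓛 e∈X (─-flipAt e∈X)
    (no  e∉X) → toggle-∉ 𝓛 X∈𝓛 Y∈𝓛 e∉X (∪-flipAt e∉X)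

  toggle-fixes : ∀ {e X} (X∈𝓛 : X ∈ᶠ 𝓛) → ¬ (flipAt e X ∈ᶠ 𝓛) →
                 toggle 𝓛 e (X , X∈𝓛) ≡ (X , X∈𝓛)
  toggle-fixes {e} {X} X∈𝓛 Y∉𝓛 = case e ∈? X of λ where
    (yes e∈X) → toggle-∈-fixed 𝓛 X∈𝓛 e∈X (Y∉𝓛 ∘ subst (_∈ᶠ 𝓛) (─-flipAt e∈X))
    (no  e∉X) → toggle-∉-fixed 𝓛 X∈𝓛 e∉X (Y∉𝓛 ∘ subst (_∈ᶠ 𝓛) (∪-flipAt e∉X))

  toggle-cases : ∀ e X → toggle 𝓛 e X ≡ X ⊎ proj₁ (toggle 𝓛 e X) ≡ flipAt e (proj₁ X)
  toggle-cases e (X , X∈𝓛) = case T? (𝓛 (flipAt e X)) of λ where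
    (yes Y∈𝓛) → inj₂ (cong proj₁ (toggle-flips X∈𝓛 Y∈𝓛))
    (no  Y∉𝓛) → inj₁ (toggle-fixes X∈𝓛 Y∉𝓛)

  toggle-lookup : ∀ {e f} X → f ≢ e → lookup (proj₁ (toggle 𝓛 e X)) f ≡ lookup (proj₁ X) f
  toggle-lookup {e} {f} X f≢e with toggle-cases e X
  ... | inj₁ eq = cong (λ Y → lookup (proj₁ Y) f) eq
  ... | inj₂ eq = trans (cong (λ Y → lookup Y f) eq) (lookup∘updateAt′ f e f≢e (proj₁ X))

-- A Boolean parameter for the side of e merges the two recursive clauses of the definition into one
-- argument.
selecting : Bool → Fin n → Family n → Family n
selecting true  = containing
selecting false = avoiding

selecting⇒ : ∀ b {e : Fin n} {𝓛 X} → X ∈ᶠ selecting b e 𝓛 → X ∈ᶠ 𝓛 × lookup X e ≡ b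
selecting⇒ true {e} {𝓛} {X} X∈ with e ∈? X | Equivalence.to (T-∧ {𝓛 X}) X∈
... | yes e∈X | X∈𝓛 , _ = X∈𝓛 , []=⇒lookup e∈X
... | no  _   | _ , ()
selecting⇒ false {e} {𝓛} {X} X∈ with e ∈? X | Equivalence.to (T-∧ {𝓛 X}) X∈
... | no  e∉X | X∈𝓛 , _ = X∈𝓛 , ∉⇒lookup e∉X
... | yes _   | _ , ()

selecting⇐ : ∀ b {e : Fin n} {𝓛 X} → X ∈ᶠ 𝓛 → lookup X e ≡ b → X ∈ᶠ selecting b e 𝓛
selecting⇐ true {e} {𝓛} {X} X∈𝓛 eq = Equivalence.from (T-∧ {𝓛 X})
  (X∈𝓛 , subst T (sym (dec-true (e ∈? X) (lookup⇒[]= e X eq))) _)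
selecting⇐ false {e} {𝓛} {X} X∈𝓛 eq = Equivalence.from (T-∧ {𝓛 X})
  (X∈𝓛 , subst (T ∘ not) (sym (dec-false (e ∈? X) (lookup⇒∉ eq))) _)

embed : ∀ b {e : Fin n} {𝓛} → Member (selecting b e 𝓛) → Member 𝓛
embed b (X , X∈) = X , proj₁ (selecting⇒ b X∈)

module _ (b : Bool) {e : Fin n} {𝓛 : Family n} where
  private
    𝓢 = selecting b e 𝓛

  -- Flipping `f ≢ e` does not change the membership of e, so the flipped set belongs to `𝓢` exactly
  -- when it belongs to `𝓛`.
  toggle-embed : ∀ {f} → f ≢ e → ∀ X → toggle 𝓛 f (embed b X) ≡ embed b (toggle 𝓢 f X)
  toggle-embed {f} f≢e (X , X∈𝓢) = case T? (𝓛 (flipAt f X)) of λ where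
    (yes Y∈𝓛) → trans (toggle-flips 𝓛 _ Y∈𝓛)
      (Member-≡ (cong proj₁ (sym (toggle-flips 𝓢 X∈𝓢 (selecting⇐ b Y∈𝓛
        (trans (lookup∘updateAt′ e f (≢-sym f≢e) X) (proj₂ (selecting⇒ b X∈𝓢))))))))
    (no  Y∉𝓛) → trans (toggle-fixes 𝓛 _ Y∉𝓛)
      (cong (embed b) (sym (toggle-fixes 𝓢 X∈𝓢 (Y∉𝓛 ∘ proj₁ ∘ selecting⇒ b))))

  toggle-selecting : ∀ X → toggle 𝓢 e X ≡ X
  toggle-selecting (X , X∈𝓢) = toggle-fixes 𝓢 X∈𝓢 λ Y∈𝓢 →
    not-¬ refl (trans (sym (proj₂ (selecting⇒ b Y∈𝓢)))
      (trans (lookup∘updateAt e X) (cong not (proj₂ (selecting⇒ b X∈𝓢)))))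

  -- A toggle at `f ≢ e` lifts to the toggle of `𝓛` at f. The toggle at e would leave the side, so
  -- on `𝓢` it is the identity and lifts to the identity.
  lift-toggleGroup : ∀ {π} → ToggleGroup 𝓢 π →
                     ∃[ h ] ToggleGroup 𝓛 h × (∀ X → to h (embed b X) ≡ embed b (to π X))
  lift-toggleGroup (gen (f , refl)) with f Fin.≟ e
  ... | yes refl = ↔-id _ , unit , λ X → cong (embed b) (sym (toggle-selecting X))
  ... | no  f≢e  = togglePerm 𝓛 f , gen (f , refl) , toggle-embed f≢e
  lift-toggleGroup unit = ↔-id _ , unit , λ _ → refl
  lift-toggleGroup (mul {y = ρ} π∈ ρ∈) with lift-toggleGroup π∈ | lift-toggleGroup ρ∈
  ... | h , h∈ , eq | h′ , h′∈ , eq′ =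
    h ↔-∘ h′ , mul h∈ h′∈ , λ X → trans (cong (to h) (eq′ X)) (eq (to ρ X))
  lift-toggleGroup (inv {π} π∈) with lift-toggleGroup π∈
  ... | h , h∈ , eq = _ , inv h∈ , λ X →
    from-≡ h (trans (eq (from π X)) (cong (embed b) (to-≡ π refl)))
  lift-toggleGroup (resp π≈ρ π∈) with lift-toggleGroup π∈
  ... | h , h∈ , eq = h , h∈ , λ X → trans (eq X) (cong (embed b) (π≈ρ X))

-- Essentializations and families with at most three members

∈-ext : {X : Subset n} {f g : Fin n} → (f ∈ X → g ∈ X) → (g ∈ X → f ∈ X) → lookup X f ≡ lookup X g
∈-ext {X = X} {f} {g} f⇒g g⇒f with lookup X f in eqf | lookup X g in eqg
... | true  | true  = refl
... | false | false = refl
... | true  | false = contradiction (f⇒g (lookup⇒[]= f X eqf)) (lookup⇒∉ eqg)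
... | false | true  = contradiction (g⇒f (lookup⇒[]= g X eqg)) (lookup⇒∉ eqf)

subset-elements : (p : Subset n) → ∀ {m} → m ℕ.≤ ∣ p ∣ →
                  Σ[ f ∈ (Fin m → Fin n) ] Injective _≡_ _≡_ f × (∀ i → f i ∈ p)
subset-elements p {zero} _ = (λ ()) , (λ { {()} }) , λ ()
subset-elements (inside ∷ p) {suc m} (s≤s m≤) with subset-elements p m≤
... | f , f-inj , f∈ = (λ { zero → zero ; (suc i) → suc (f i) })
  , (λ { {zero} {zero} _ → refl ; {suc i} {suc j} eq → cong suc (f-inj (Fin.suc-injective eq)) })
  , λ { zero → here ; (suc i) → there (f∈ i) }
subset-elements (outside ∷ p) {suc m} m≤ with subset-elements p m≤
... | f , f-inj , f∈ = suc ∘ f , f-inj ∘ Fin.suc-injective , there ∘ f∈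

-- Pigeonhole classes for `three-members`: one for e alone, two for the other elements according to
-- their membership in P.
colour : Subset n → Fin n → Fin n → Fin 3
colour P e g with g Fin.≟ e | lookup P g
... | yes _ | _     = zero
... | no  _ | true  = suc zero
... | no  _ | false = suc (suc zero)

colour-≡ : ∀ (P : Subset n) e {g h} → colour P e g ≡ colour P e h →
          g ≡ h ⊎ (g ≢ e × h ≢ e × lookup P g ≡ lookup P h)
colour-≡ P e {g} {h} eq with g Fin.≟ e | h Fin.≟ e | lookup P g | lookup P h
... | yes refl | yes refl | _     | _     = inj₁ refl
... | no  g≢e  | no  h≢e  | true  | true  = inj₂ (g≢e , h≢e , refl)
... | no  g≢e  | no  h≢e  | false | false = inj₂ (g≢e , h≢e , refl)
colour-≡ P e () | yes _ | no _  | _     | true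
colour-≡ P e () | yes _ | no _  | _     | false
colour-≡ P e () | no _  | yes _ | true  | _
colour-≡ P e () | no _  | yes _ | false | _
colour-≡ P e () | no _  | no _  | true  | false
colour-≡ P e () | no _  | no _  | false | true

module _ {𝓛 𝓛′ : Family n} {E′ : Subset n} (ess : IsEssentialization 𝓛 𝓛′ E′) where
  open IsEssentialization ess

  -- If f and g were distinct, the elements that agree with f on all of `𝓛` would form a maximal
  -- bundle containing both, and an essentialization keeps at most one of its elements.
  essential-separated : ∀ {f g} → f ∈ E′ → g ∈ E′ → (∀ {W} → W ∈ᶠ 𝓛 → lookup W f ≡ lookup W g) → f ≡ g
  essential-separated {f} {g} f∈E′ g∈E′ same = decidable-stable (f Fin.≟ g) λ f≢g →
    let z , _ , excluded , _ = bundled (maximal f≢g) in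
    case f Fin.≟ z of λ where
      (no  f≢z) → excluded (⇒∈Z (λ _ → refl)) f≢z f∈E′
      (yes f≡z) → excluded (⇒∈Z (sym ∘ same)) (λ g≡z → f≢g (trans f≡z (sym g≡z))) g∈E′
    where
    Differs : Fin n → Subset n → Set
    Differs h W = W ∈ᶠ 𝓛 × lookup W h ≢ lookup W f

    differs? : ∀ h → Dec (∃[ W ] Differs h W)
    differs? h = anySubset? (λ W → T? (𝓛 W) ×-dec ¬? (lookup W h ≟ᵇ lookup W f))

    Z : Subset n
    Z = tabulate (λ h → not (does (differs? h)))

    ⇒∈Z : ∀ {h} → (∀ {W} → W ∈ᶠ 𝓛 → lookup W h ≡ lookup W f) → h ∈ Z
    ⇒∈Z {h} agree = lookup⇒[]= h Z (trans (lookup∘tabulate _ h)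
      (cong not (dec-false (differs? h) λ (W , W∈𝓛 , ne) → ne (agree W∈𝓛))))

    ∈Z⇒ : ∀ {h} → h ∈ Z → ∀ {W} → W ∈ᶠ 𝓛 → lookup W h ≡ lookup W f
    ∈Z⇒ {h} h∈Z {W} W∈𝓛 = decidable-stable (lookup W h ≟ᵇ lookup W f) λ ne →
      case trans (sym ([]=⇒lookup h∈Z)) (trans (lookup∘tabulate _ h)
             (cong not (dec-true (differs? h) (W , W∈𝓛 , ne)))) of λ ()

    maximal : f ≢ g → MaximalBundle 𝓛 Z
    maximal f≢g =
      -- The singleton of f is a proper subset of Z because g is also in Z, so Z has more than one
      -- element.
      ( subst (ℕ._< ∣ Z ∣) (∣⁅x⁆∣≡1 f) (p⊂q⇒∣p∣<∣q∣
          ( (λ h∈ → subst (_∈ Z) (sym (x∈⁅y⁆⇒x≡y f h∈)) (⇒∈Z (λ _ → refl)))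
          , g , ⇒∈Z (sym ∘ same) , f≢g ∘ sym ∘ x∈⁅y⁆⇒x≡y f))
      , λ h∈Z h∈W W∈𝓛 {h′} h′∈Z → lookup⇒[]= h′ _
          (trans (∈Z⇒ h′∈Z W∈𝓛) (trans (sym (∈Z⇒ h∈Z W∈𝓛)) ([]=⇒lookup h∈W))) )
      , λ (_ , closed) Z⊆Z′ h∈Z′ → ⇒∈Z λ W∈𝓛 → let f∈Z′ = Z⊆Z′ (⇒∈Z (λ _ → refl)) in
          ∈-ext (λ h∈W → closed h∈Z′ h∈W W∈𝓛 f∈Z′) (λ f∈W → closed f∈Z′ f∈W W∈𝓛 h∈Z′)

  -- Away from e, an essential element distinguishes P from both X and Y, so it is
  -- determined by its value on P, and E′ has at most three elements.
  three-members : ∀ {P X Y e} → 5 ℕ.≤ ∣ E′ ∣ →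
                  (∀ {W} → W ∈ᶠ 𝓛 → W ≡ P ⊎ W ≡ X ⊎ W ≡ Y) →
                  ¬ (∀ f → f ≢ e → lookup X f ≡ lookup Y f)
  three-members {P} {X} {Y} {e} 5≤∣E′∣ only same
    with subset-elements E′ 5≤∣E′∣
  ... | f , f-inj , f∈E′ with Fin.pigeonhole {3} (s≤s (s≤s (s≤s (s≤s z≤n)))) (colour P e ∘ f)
  ...   | i , j , i<j , eq = Fin.<⇒≢ i<j (f-inj (colour-injective (f∈E′ i) (f∈E′ j) eq))
    where
    opposite : ∀ {g} → g ∈ E′ → g ≢ e → lookup X g ≡ not (lookup P g)
    -- If X agreed with P at g, so would Y, which equals X away from e. Then g would be constant on
    -- `𝓛` and not essential.
    opposite {g} g∈E′ g≢e = ¬-not λ XPg →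
      let (V , V∈𝓛 , g∈V) , (W , W∈𝓛 , g∉W) = essential g∈E′
          constant : ∀ {W} → W ∈ᶠ 𝓛 → lookup W g ≡ lookup P g
          constant W∈𝓛 = case only W∈𝓛 of λ where
            (inj₁ refl)        → refl
            (inj₂ (inj₁ refl)) → XPg
            (inj₂ (inj₂ refl)) → trans (sym (same _ g≢e)) XPg
      in g∉W (lookup⇒[]= g W (trans (constant W∈𝓛) (trans (sym (constant V∈𝓛)) ([]=⇒lookup g∈V))))

    determined : ∀ {g h} → g ∈ E′ → h ∈ E′ → g ≢ e → h ≢ e → lookup P g ≡ lookup P h → g ≡ h
    determined {g} {h} g∈E′ h∈E′ g≢e h≢e eqP =
      essential-separated g∈E′ h∈E′ λ W∈𝓛 → case only W∈𝓛 of λ where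
        (inj₁ refl)        → eqP
        (inj₂ (inj₁ refl)) → eqX
        (inj₂ (inj₂ refl)) → trans (sym (same _ g≢e)) (trans eqX (same _ h≢e))
      where
      eqX : lookup X g ≡ lookup X h
      eqX = trans (opposite g∈E′ g≢e) (trans (cong not eqP) (sym (opposite h∈E′ h≢e)))

    colour-injective : ∀ {g h} → g ∈ E′ → h ∈ E′ → colour P e g ≡ colour P e h → g ≡ h
    colour-injective g∈E′ h∈E′ eq with colour-≡ P e eq
    ... | inj₁ g≡h               = g≡h
    ... | inj₂ (g≢e , h≢e , eqP) = determined g∈E′ h∈E′ g≢e h≢e eqP

-- The induction step for a covered side

module CoveredSide (b : Bool) {𝓛 𝓛′ : Family n} {E′ : Subset n} {e : Fin n}
         (ess : IsEssentialization 𝓛 𝓛′ E′) (5≤∣E′∣ : 5 ℕ.≤ ∣ E′ ∣) (e∈E′ : e ∈ E′)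
         (𝓢-alternating : ToggleAlternating (selecting b e 𝓛))
         (covered : ToggleCovered 𝓛 e (selecting b e 𝓛)) where
  open ToggleCovered covered
  private
    𝓢 = selecting b e 𝓛
    𝓒 = selecting (not b) e 𝓛

  -- Being essential, e takes both values on `𝓛`. Hence the other side is nonempty and its size is a
  -- successor, as `Covering` requires.
  outsider : Member 𝓒
  outsider = case b ≟ᵇ true of λ where
    (yes refl) → let _ , (Y , Y∈𝓛 , e∉Y) = IsEssentialization.essential ess e∈E′ in
                 Y , selecting⇐ false {e} {𝓛} Y∈𝓛 (∉⇒lookup e∉Y)
    (no b≢true) → case ¬-not b≢true of λ where
      refl → let (X , X∈𝓛 , e∈X) , _ = IsEssentialization.essential ess e∈E′ in
             X , selecting⇐ true {e} {𝓛} X∈𝓛 ([]=⇒lookup e∈X)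

  ι : Member 𝓢 → Member 𝓛
  ι = embed b

  ι-injective : Injective _≡_ _≡_ ι
  ι-injective eq = Member-≡ (cong proj₁ eq)

  -- A toggle that really flips e leaves `𝓢`; a member of `𝓢` whose image is again in `𝓢` is
  -- therefore fixed.
  fixed-member : ∃[ p ] toggle 𝓛 e (ι p) ≡ ι p
  fixed-member with meets
  ... | Y , Y∈𝓢 , X , X∈𝓢 , tX≡Y with toggle-cases 𝓛 e X
  ...   | inj₁ tX≡X =
    (proj₁ X , X∈𝓢) , trans (cong (toggle 𝓛 e) (Member-≡ refl)) (trans tX≡X (Member-≡ refl))
  ...   | inj₂ flips = contradiction
    (trans (sym (proj₂ (selecting⇒ b Y∈𝓢))) (trans (cong (λ W → lookup (proj₁ W) e) (sym tX≡Y))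
      (trans (cong (λ W → lookup W e) flips) (trans (lookup∘updateAt e (proj₁ X))
        (cong not (proj₂ (selecting⇒ b X∈𝓢)))))))
    (not-¬ refl)

  module _ {k : ℕ} (enum : Fin (suc k) ↔ Member 𝓒) where

    κ : Fin (suc k) → Member 𝓛
    κ = embed (not b) ∘ to enum

    κ-injective : Injective _≡_ _≡_ κ
    κ-injective {i} {j} eq = trans (sym (Inverse.inverseʳ enum refl))
      (Inverse.inverseʳ enum {j} (Member-≡ {X = to enum i} {to enum j} (cong proj₁ eq)))

    split : ∀ W → (∃[ X ] ι X ≡ W) ⊎ (∃[ i ] κ i ≡ W)
    split (W , W∈𝓛) = case lookup W e ≟ᵇ b of λ where
      (yes eq) → inj₁ ((W , selecting⇐ b W∈𝓛 eq) , Member-≡ refl)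
      (no  ne) → let Y = W , selecting⇐ (not b) W∈𝓛 (¬-not ne) in
                 inj₂ (from enum Y , Member-≡ (cong proj₁ (Inverse.inverseˡ enum {Y} refl)))

    ι≢κ : ∀ {X i} → ι X ≢ κ i
    ι≢κ {X} {i} eq = not-¬ refl (trans (sym (proj₂ (selecting⇒ b (proj₂ X))))
      (trans (cong (λ W → lookup (proj₁ W) e) eq) (proj₂ (selecting⇒ (not b) (proj₂ (to enum i))))))

    -- A member of the other side is not in `𝓢`, so the covering condition places it in the toggle
    -- image of `𝓢`.
    toggle-covers : ∀ i → ∃[ X ] toggle 𝓛 e (ι X) ≡ κ i
    toggle-covers i with covers (κ i)
    ... | inj₁ κi∈𝓢 = contradiction (Member-≡ {X = ι (proj₁ (κ i) , κi∈𝓢)} refl) ι≢κ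
    ... | inj₂ (X , X∈𝓢 , tX≡κi) = (proj₁ X , X∈𝓢) , trans (cong (toggle 𝓛 e) (Member-≡ refl)) tX≡κi

    p : Member 𝓢
    p = proj₁ fixed-member

    -- Otherwise `𝓛` consists of p, X and the single member of `𝓒`. The toggle fixes p, so that
    -- member is the toggle of X and differs from X only at e, which `three-members` excludes.
    third : k ≡ 0 → ∀ X → ∃[ Z ] Z ≢ p × Z ≢ X
    third refl X with Member-finite 𝓢
    ... | m , members with Fin.any? (λ i → ¬? (to members i ≟ᵐ p) ×-dec ¬? (to members i ≟ᵐ X))
    ...   | yes (i , Z≢p , Z≢X) = to members i , Z≢p , Z≢X
    ...   | no  none = contradiction same (three-members ess 5≤∣E′∣ only)
      where
      p-or-X : ∀ Z → Z ≡ p ⊎ Z ≡ X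
      p-or-X Z with Z ≟ᵐ p | Z ≟ᵐ X
      ... | yes Z≡p | _       = inj₁ Z≡p
      ... | no  _   | yes Z≡X = inj₂ Z≡X
      ... | no  Z≢p | no  Z≢X = contradiction
        (from members Z , subst (λ W → W ≢ p × W ≢ X) (sym (Inverse.inverseˡ members refl)) (Z≢p , Z≢X)) none

      only : ∀ {W} → W ∈ᶠ 𝓛 → W ≡ proj₁ p ⊎ W ≡ proj₁ X ⊎ W ≡ proj₁ (κ zero)
      only {W} W∈𝓛 with split (W , W∈𝓛)
      ... | inj₂ (zero , eq) = inj₂ (inj₂ (cong proj₁ (sym eq)))
      ... | inj₁ (Z , eq) with p-or-X Z
      ...   | inj₁ refl = inj₁ (cong proj₁ (sym eq))
      ...   | inj₂ refl = inj₂ (inj₁ (cong proj₁ (sym eq)))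

      toggle-X : toggle 𝓛 e (ι X) ≡ κ zero
      toggle-X with toggle-covers zero
      ... | Y , tY≡κ with p-or-X Y
      ...   | inj₁ refl = contradiction (trans (sym (proj₂ fixed-member)) tY≡κ) ι≢κ
      ...   | inj₂ refl = tY≡κ

      same : ∀ f → f ≢ e → lookup (proj₁ X) f ≡ lookup (proj₁ (κ zero)) f
      same f f≢e = trans (sym (toggle-lookup 𝓛 (ι X) f≢e)) (cong (λ W → lookup (proj₁ W) f) toggle-X)

    covered⇒alternating : ToggleAlternating 𝓛
    covered⇒alternating {π} = Covering.alternating⊆G _≟ᵐ_ _≟ᵐ_ _ ι ι-injective κ κ-injective split
      (λ {X} {i} → ι≢κ {X} {i})
      (λ {ρ} alt → lift-toggleGroup b (𝓢-alternating {ρ} alt))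
      {togglePerm 𝓛 e} (gen (e , refl)) {p} (proj₂ fixed-member)
      (proj₁ ∘ toggle-covers) (proj₂ ∘ toggle-covers)
      (λ i → trans (cong (toggle 𝓛 e) (sym (proj₂ (toggle-covers i)))) (toggle-involutive 𝓛 e _))
      third {π}

  alternating : ToggleAlternating 𝓛
  alternating {π} with Member-finite 𝓒
  ... | zero  , enum = case from enum outsider of λ ()
  ... | suc k , enum = covered⇒alternating enum {π}

theorem2p22 : (n : ℕ) (𝓛 : Family n) → InductivelyToggleAlternating 𝓛 → ToggleAlternating 𝓛
theorem2p22 n 𝓛 (small _ _ 𝓛-alternating) = 𝓛-alternating
theorem2p22 n 𝓛 (with-e ess 5≤∣E′∣ e∈E′ ind covered) {π} =
  CoveredSide.alternating true ess 5≤∣E′∣ e∈E′ (λ {ρ} → theorem2p22 n _ ind {ρ}) covered {π}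
theorem2p22 n 𝓛 (without-e ess 5≤∣E′∣ e∈E′ ind covered) {π} =
  CoveredSide.alternating false ess 5≤∣E′∣ e∈E′ (λ {ρ} → theorem2p22 n _ ind {ρ}) covered {π}
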